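{- Let $(\Sigma,I)$ be a trace alphabet, let $\varphi$ be a formula of $\mathrm{LTL}(\Sigma,I)$, and let $u\in\Sigma^\ast$. Then for every $v\in\Sigma^\ast$ with $v\approx u$ (i.e. every $v\in[u]_{\approx}$), $$[u\models^{t}\varphi]=[v\models^{t}\varphi].$$
   Context: **Trace alphabet.** A trace alphabet is a pair $(\Sigma,I)$ where $\Sigma$ is a finite non-empty set and $I\subseteq\Sigma\times\Sigma$ is irreflexive and symmetric (independence). Put $D=(\Sigma\times\Sigma)\setminus I$ (dependency). $\Sigma^\infty=\Sigma^\ast\cup\Sigma^\omega$ is the set of finite and infinite words. **Traces.** A trace over $(\Sigma,I)$ is a $\Sigma$-labelled poset $T=(E,\leq,\lambda)$, $\lambda:E\to\Sigma$, such that: (i) ${\downarrow}e=\{x\in E\mid x\le e\}$ is finite for every $e\in E$; (ii) if $e'$ covers $e$ (i.e. $e<e'$ and nothing lies strictly between), then $(\lambda(e),\lambda(e'))\in D$; (iii) if $(\lambda(e),\lambda(e'))\in D$ then $e\le e'$ or $e'\le e$. Isomorphic traces are identified. **Configurations.** A configuration of $T$ is a finite set $c\subseteq E$ that is downward closed. $\mathcal C_T$ is the set of configurations. For $c,c'\in\mathcal C_T$ and $a\in\Sigma$, $c\xrightarrow{a}_T c'$ means there is $e\in E\setminus c$ with $\lambda(e)=a$ and $c'=c\cup\{e\}$. **Linearisations and equivalence.** $w\in\Sigma^\infty$ is a linearisation of $T$ iff there is a map $\rho$ from the finite prefixes of $w$ to $\mathcal C_T$ with $\rho(\varepsilon)=\emptyset$,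 $\rho(v)\xrightarrow{a}_T\rho(va)$ for each finite prefix $va$ of $w$, and every $e\in E$ belongs to $\rho(u)$ for some finite prefix $u$ of $w$. For $w,w'\in\Sigma^\infty$, $w\approx w'$ iff $w{\upharpoonright}p=w'{\upharpoonright}p$ for every $p\subseteq\Sigma$ with $p\times p\subseteq D$, where $w{\upharpoonright}p$ erases from $w$ all letters not in $p$. The equivalence class of $w$ is $[w]_\approx$. For $w\in\Sigma^\infty$, $T_w$ is the unique (up to isomorphism) trace having $w$ as a linearisation; its set of linearisations is $[w]_\approx$. (Concretely: events are the positions of $w$, labelled by their letters, and $\le$ is the reflexive-transitive closure of $\{(i,j)\mid i<j,\ (w_i,w_j)\in D\}$.) **Logic.** Formulas of $\mathrm{LTL}(\Sigma,I)$ (also called LTrL) are given by $\varphi::=\mathrm{tt}\mid\neg\varphi\mid\varphi\vee\psi\mid\langle a\rangle\varphi\mid\varphi\,\mathcal U\,\psi$ with $a\in\Sigma$. For a trace $T$ and $c\in\mathcal C_T$: $T,c\models\mathrm{tt}$ always; $\neg,\vee$ are interpreted as usual; $T,c\models\langle a\rangle\varphi$ iff there is $c'\in\mathcal C_T$ with $c\xrightarrow{a}_T c'$ and $T,c'\models\varphi$; $T,c\models\varphi\,\mathcal U\,\psi$ iff there is $c'\in\mathcal C_T$ with $c\subseteq c'$, $T,c'\models\psi$, and $T,c''\models\varphi$ for all $c''\in\mathcal C_T$ with $c\subseteq c''\subsetneq c'$. $T\models\varphi$ means $T,\emptyset\models\varphi$. **Three-valued semantics.** For $u\in\Sigma^\ast$,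 the value $[u\models^{t}\varphi]\in\{\bot,?,\top\}$ is $\top$ if $T_{u\sigma}\models\varphi$ for all $\sigma\in\Sigma^\omega$; $\bot$ if $T_{u\sigma}\not\models\varphi$ for all $\sigma\in\Sigma^\omega$; and $?$ otherwise. -}

module Defs where

open import Data.Bool using (Bool; T)
open import Data.Empty using (⊥; ⊥-elim)
open import Data.Fin using (Fin; zero)
open import Data.List using (List; []; _∷_; _++_; filterᵇ)
open import Data.List.Membership.Propositional using (_∈_)
open import Data.List.Membership.Propositional.Properties using (∈-++⁺ˡ; ∈-++⁺ʳ; ∈-++⁻)
open import Data.List.Relation.Unary.Any using (here; there)
open import Data.Nat as ℕ using (ℕ; zero; suc)
open import Data.Nat.Induction using (<-rec)
open import Data.Nat.Properties as ℕₚ using (<-cmp)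
open import Data.Product using (∃; _×_; _,_; proj₁; proj₂)
open import Data.Unit.Polymorphic using (⊤)
open import Data.Sum using (_⊎_; inj₁; inj₂)
open import Function using (_∘_)
open import Function.Bundles using (_↔_; Inverse)
open import Level using (0ℓ)
open import Relation.Binary using (Rel; Decidable; Irreflexive; Symmetric; IsPartialOrder; tri<; tri≈; tri>)
open import Relation.Binary.Construct.Closure.ReflexiveTransitive using (Star; ε; _◅_; _◅◅_)
open import Relation.Binary.PropositionalEquality using (_≡_; _≢_; refl; isEquivalence)
import Relation.Binary.Construct.NonStrictToStrict as ToStrict
open import Relation.Nullary using (¬_; Dec; yes; no; ¬?)
open import Relation.Unary using (Pred; _⊆_; _⊂_; _≐_; _∪_; ｛_｝)

Finite : ∀ {A : Set} → Pred A 0ℓ → Set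
Finite P = ∃ λ xs → P ≐ (_∈ xs)

private
  variable
    A : Set

  finite-≐ : {P Q : Pred A 0ℓ} → P ≐ Q → Finite P → Finite Q
  finite-≐ (P⊆Q , Q⊆P) (xs , P⊆xs , xs⊆P) = xs , P⊆xs ∘ Q⊆P , P⊆Q ∘ xs⊆P

  finite-∅ : {P : Pred A 0ℓ} → (∀ {x} → ¬ P x) → Finite P
  finite-∅ ¬P = [] , ⊥-elim ∘ ¬P , λ ()

  finite-｛｝ : (x : A) → Finite ｛ x ｝
  finite-｛｝ x = x ∷ [] , (λ { refl → here refl }) , λ { (here refl) → refl ; (there ()) }

  finite-∪ : {P Q : Pred A 0ℓ} → Finite P → Finite Q → Finite (P ∪ Q)
  finite-∪ (xs , P⊆xs , xs⊆P) (ys , Q⊆ys , ys⊆Q) =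
    xs ++ ys
    , (λ { (inj₁ p) → ∈-++⁺ˡ (P⊆xs p) ; (inj₂ q) → ∈-++⁺ʳ xs (Q⊆ys q) })
    , λ m → split (∈-++⁻ xs m)
    where
    split : ∀ {x} → x ∈ xs ⊎ x ∈ ys → _
    split (inj₁ m) = inj₁ (xs⊆P m)
    split (inj₂ m) = inj₂ (ys⊆Q m)

  finite-guard : {G : Set} {P : Pred A 0ℓ} → Dec G → Finite P → Finite (λ x → G × P x)
  finite-guard (yes g) P-fin = finite-≐ ((g ,_) , proj₂) P-fin
  finite-guard (no ¬g) P-fin = finite-∅ (¬g ∘ proj₁)

  finite-⋃ : (P : ℕ → Pred A 0ℓ) (n : ℕ) → (∀ {k} → k ℕ.< n → Finite (P k)) →
             Finite (λ x → ∃ λ k → k ℕ.< n × P k x)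
  finite-⋃ P zero    fin = finite-∅ λ { (_ , () , _) }
  finite-⋃ P (suc n) fin =
    finite-≐ (to , from) (finite-∪ (fin ℕₚ.≤-refl) (finite-⋃ P n (fin ∘ ℕₚ.m<n⇒m<1+n)))
    where
    to : ∀ {x} → P n x ⊎ (∃ λ k → k ℕ.< n × P k x) → ∃ λ k → k ℕ.< suc n × P k x
    to (inj₁ p)             = n , ℕₚ.≤-refl , p
    to (inj₂ (k , k<n , p)) = k , ℕₚ.m<n⇒m<1+n k<n , p

    from : ∀ {x} → (∃ λ k → k ℕ.< suc n × P k x) → P n x ⊎ (∃ λ k → k ℕ.< n × P k x)
    from (k , k<1+n , p) with ℕₚ.m<1+n⇒m<n∨m≡n k<1+n
    ... | inj₁ k<n  = inj₂ (k , k<n , p)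
    ... | inj₂ refl = inj₁ p

record TraceAlphabet : Set₁ where
  field
    Letter    : Set
    predSize  : ℕ
    enumerate : Letter ↔ Fin (suc predSize)
    I         : Rel Letter 0ℓ
    -- Classically automatic for a subset of a finite set.
    I?        : Decidable I
    I-irrefl  : Irreflexive _≡_ I
    I-sym     : Symmetric I

  D : Rel Letter 0ℓ
  D a b = ¬ I a b

data 𝔹₃ : Set where
  ⊥₃ ?₃ ⊤₃ : 𝔹₃

module OverAlphabet (𝔸 : TraceAlphabet) where
  open TraceAlphabet 𝔸 public

  Word : Set
  Word = List Letter

  ωWord : Set
  ωWord = ℕ → Letter

  infixr 5 _⌢_
  _⌢_ : Word → ωWord → ωWord
  ([] ⌢ σ)      n       = σ n
  ((a ∷ u) ⌢ σ) zero    = a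
  ((a ∷ u) ⌢ σ) (suc n) = (u ⌢ σ) n

  -- Subsets p of the alphabet are given by characteristic functions.
  _↾_ : Word → (Letter → Bool) → Word
  w ↾ p = filterᵇ p w

  DClique : (Letter → Bool) → Set
  DClique p = ∀ a b → T (p a) → T (p b) → D a b

  infix 4 _≈_
  _≈_ : Rel Word 0ℓ
  w ≈ w′ = ∀ p → DClique p → w ↾ p ≡ w′ ↾ p

  record Trace : Set₁ where
    field
      E              : Set
      _≤_            : Rel E 0ℓ
      label          : E → Letter
      isPartialOrder : IsPartialOrder _≡_ _≤_

    open ToStrict _≡_ _≤_ public using (_<_)

    Covers : Rel E 0ℓ
    Covers e e′ = e < e′ × (∀ x → ¬ (e < x × x < e′))

    field
      ↓-finite      : ∀ e → Finite (_≤ e)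
      covers⇒D      : ∀ {e e′} → Covers e e′ → D (label e) (label e′)
      D⇒comparable  : ∀ {e e′} → D (label e) (label e′) → e ≤ e′ ⊎ e′ ≤ e

  module _ (𝕋 : Trace) where
    open Trace 𝕋

    record Configuration : Set₁ where
      field
        events     : Pred E 0ℓ
        finite     : Finite events
        downClosed : ∀ {x e} → x ≤ e → events e → events x

    open Configuration

    ∅ᶜ : Configuration
    ∅ᶜ = record
      { events     = λ _ → ⊥
      ; finite     = finite-∅ λ ()
      ; downClosed = λ _ ()
      }

    Step : Letter → Rel Configuration 0ℓ
    Step a c c′ = ∃ λ e → ¬ events c e × label e ≡ a × events c′ ≐ events c ∪ ｛ e ｝

  open Configuration public

  data LTL : Set where
    tt   : LTL
    ¬′_  : LTL → LTL
    _∨′_ : LTL → LTL → LTL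
    ⟨_⟩_ : Letter → LTL → LTL
    _U_  : LTL → LTL → LTL

  infix 4 _,_⊨_ _⊨_
  _,_⊨_ : (𝕋 : Trace) → Configuration 𝕋 → LTL → Set₁
  𝕋 , c ⊨ tt       = ⊤
  𝕋 , c ⊨ (¬′ φ)   = ¬ (𝕋 , c ⊨ φ)
  𝕋 , c ⊨ (φ ∨′ ψ) = (𝕋 , c ⊨ φ) ⊎ (𝕋 , c ⊨ ψ)
  𝕋 , c ⊨ (⟨ a ⟩ φ) = ∃ λ c′ → Step 𝕋 a c c′ × (𝕋 , c′ ⊨ φ)
  𝕋 , c ⊨ (φ U ψ)  = ∃ λ c′ → events c ⊆ events c′ × (𝕋 , c′ ⊨ ψ) ×
    (∀ c″ → events c ⊆ events c″ → events c″ ⊂ events c′ → 𝕋 , c″ ⊨ φ)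

  _⊨_ : Trace → LTL → Set₁
  𝕋 ⊨ φ = 𝕋 , ∅ᶜ 𝕋 ⊨ φ

  module _ (w : ωWord) where

    Earlier : Rel ℕ 0ℓ
    Earlier i j = i ℕ.< j × D (w i) (w j)

    private
      Star⇒≤ : ∀ {i j} → Star Earlier i j → i ℕ.≤ j
      Star⇒≤ ε               = ℕₚ.≤-refl
      Star⇒≤ ((i<k , _) ◅ s) = ℕₚ.≤-trans (ℕₚ.<⇒≤ i<k) (Star⇒≤ s)

      Below : ℕ → Pred ℕ 0ℓ
      Below j i = Star Earlier i j

      LastStep : ℕ → Pred ℕ 0ℓ
      LastStep j i = ∃ λ k → k ℕ.< j × D (w k) (w j) × Below k i

      unsnoc : ∀ {i j} → Below j i → j ≡ i ⊎ LastStep j i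
      unsnoc ε = inj₁ refl
      unsnoc (s ◅ ss) with unsnoc ss
      ... | inj₁ refl                = inj₂ (_ , proj₁ s , proj₂ s , ε)
      ... | inj₂ (k , k<j , d , ss′) = inj₂ (k , k<j , d , s ◅ ss′)

      snoc : ∀ {i j} → j ≡ i ⊎ LastStep j i → Below j i
      snoc (inj₁ refl)               = ε
      snoc (inj₂ (k , k<j , d , ss)) = ss ◅◅ ((k<j , d) ◅ ε)

      below-finite : ∀ j → Finite (Below j)
      below-finite = <-rec (λ j → Finite (Below j)) λ j rec →
        finite-≐ (snoc , unsnoc)
          (finite-∪ (finite-｛｝ j)
            (finite-⋃ _ j λ k<j → finite-guard (¬? (I? _ _)) (rec k<j)))

      Star-antisym : ∀ {i j} → Star Earlier i j → Star Earlier j i → i ≡ j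
      Star-antisym p q = ℕₚ.≤-antisym (Star⇒≤ p) (Star⇒≤ q)

      cover⇒D : ∀ {i j} → Star Earlier i j → i ≢ j →
                (∀ k → ¬ ((Star Earlier i k × i ≢ k) × (Star Earlier k j × k ≢ j))) →
                D (w i) (w j)
      cover⇒D ε i≢i _ = ⊥-elim (i≢i refl)
      cover⇒D {i} {j} (_◅_ {j = k} (i<k , d) ss) _ none with k ℕ.≟ j
      ... | yes refl = d
      ... | no k≢j   = ⊥-elim (none k ((((i<k , d) ◅ ε) , ℕₚ.<⇒≢ i<k) , ss , k≢j))

      comparable : ∀ {i j} → D (w i) (w j) → Star Earlier i j ⊎ Star Earlier j i
      comparable {i} {j} d with <-cmp i j
      ... | tri< i<j _ _ = inj₁ ((i<j , d) ◅ ε)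
      ... | tri≈ _ refl _ = inj₁ ε
      ... | tri> _ _ j<i = inj₂ ((j<i , d ∘ I-sym) ◅ ε)

    traceOf : Trace
    traceOf = record
      { E              = ℕ
      ; _≤_            = Star Earlier
      ; label          = w
      ; isPartialOrder = record
        { isPreorder = record
          { isEquivalence = isEquivalence
          ; reflexive     = λ { refl → ε }
          ; trans         = _◅◅_
          }
        ; antisym = Star-antisym
        }
      ; ↓-finite       = below-finite
      ; covers⇒D       = λ { ((p , i≢j) , none) → cover⇒D p i≢j none }
      ; D⇒comparable   = comparable
      }

  -- [ u ⊨ᵗ φ ]≔ b says that the three-valued semantics takes the value b. It is
  -- a relation because choosing b is not computable; value-unique and
  -- value-exists show that it is classically the graph of a function.
  [_⊨ᵗ_]≔_ : Word → LTL → 𝔹₃ → Set₁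
  [ u ⊨ᵗ φ ]≔ ⊤₃ = ∀ σ → traceOf (u ⌢ σ) ⊨ φ
  [ u ⊨ᵗ φ ]≔ ⊥₃ = ∀ σ → ¬ (traceOf (u ⌢ σ) ⊨ φ)
  [ u ⊨ᵗ φ ]≔ ?₃ = ¬ ([ u ⊨ᵗ φ ]≔ ⊤₃) × ¬ ([ u ⊨ᵗ φ ]≔ ⊥₃)

  value-unique : ∀ u φ {b b′} → [ u ⊨ᵗ φ ]≔ b → [ u ⊨ᵗ φ ]≔ b′ → b ≡ b′
  value-unique u φ {⊥₃} {⊥₃} p q = refl
  value-unique u φ {⊥₃} {?₃} p q = ⊥-elim (proj₂ q p)
  value-unique u φ {⊥₃} {⊤₃} p q = ⊥-elim (p σ₀ (q σ₀))
    where σ₀ = λ _ → Inverse.from enumerate zero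
  value-unique u φ {?₃} {⊥₃} p q = ⊥-elim (proj₂ p q)
  value-unique u φ {?₃} {?₃} p q = refl
  value-unique u φ {?₃} {⊤₃} p q = ⊥-elim (proj₁ p q)
  value-unique u φ {⊤₃} {⊥₃} p q = ⊥-elim (q σ₀ (p σ₀))
    where σ₀ = λ _ → Inverse.from enumerate zero
  value-unique u φ {⊤₃} {?₃} p q = ⊥-elim (proj₁ q p)
  value-unique u φ {⊤₃} {⊤₃} p q = refl

  value-exists : ∀ u φ → ¬ ¬ (∃ λ b → [ u ⊨ᵗ φ ]≔ b)
  value-exists u φ none = none (?₃ , (λ p → none (⊤₃ , p)) , (λ p → none (⊥₃ , p)))

{-# OPTIONS --safe #-}
-- If a v ≈ u, then u = u₁ a u₂ with a independent of all letters of u₁: the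
-- projections to the cliques {a , b} all start with a. Hence a can be moved to
-- the front of u by transpositions of adjacent independent letters, and what
-- remains satisfies v ≈ u₁ u₂. Each transposition is an isomorphism of the
-- traces of the words continued by σ, and isomorphic traces satisfy the same
-- formulas.
module Submission where

open import Defs
open import Data.Bool using (Bool; true; false; T; _∨_)
open import Data.Bool.Properties using (T-∨)
open import Data.Empty using (⊥-elim)
open import Data.Fin.Properties using () renaming (_≟_ to _≟ᶠ_)
open import Data.List using ([]; _∷_; _++_; map)
open import Data.List.Membership.Propositional using (_∈_)
open import Data.List.Membership.Propositional.Properties using (∈-map⁺; ∈-map⁻)
open import Data.List.Properties using (∷-injectiveˡ; ∷-injectiveʳ)
open import Data.List.Relation.Unary.All using (All; []; _∷_)
open import Data.Nat as ℕ using (ℕ; zero; suc; z<s; s<s)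
open import Data.Product using (∃; ∃₂; _×_; _,_; proj₁; proj₂)
open import Data.Sum as Sum using (_⊎_; inj₁; inj₂)
open import Function using (_∘_; _$_)
open import Function.Bundles using (_⇔_; _↔_; Inverse; Equivalence; mk⇔; mk↔ₛ′)
open import Function.Construct.Composition using (_↔-∘_)
open import Function.Construct.Identity using (↔-id)
open import Function.Construct.Symmetry using (↔-sym)
open import Function.Properties.Inverse using (↔⇒↣)
open import Relation.Binary.Construct.Closure.ReflexiveTransitive using (gmap)
open import Relation.Binary.Definitions using (DecidableEquality)
open import Relation.Binary.PropositionalEquality using (_≡_; refl; sym; trans; cong; subst; subst₂)
open import Relation.Nullary using (yes; no)
open import Relation.Nullary.Decidable using (⌊_⌋; via-injection; toWitness)
open import Relation.Unary using (_⊆_)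

module TraceEquivalence (𝔸 : TraceAlphabet) where
  open OverAlphabet 𝔸

  -- Makes the two-letter cliques `pair a b` Boolean-valued, as `_↾_` requires.
  _≟_ : DecidableEquality Letter
  _≟_ = via-injection (↔⇒↣ enumerate) _≟ᶠ_

  D-refl : ∀ {a} → D a a
  D-refl = I-irrefl refl

  D-sym : ∀ {a b} → D a b → D b a
  D-sym d = d ∘ I-sym

  -- Trace isomorphisms preserve satisfaction.

  record _≅_ (𝕋 𝕋′ : Trace) : Set where
    private
      module 𝕋  = Trace 𝕋
      module 𝕋′ = Trace 𝕋′
    field
      bijection : 𝕋.E ↔ 𝕋′.E
    open Inverse bijection public
    field
      label-to  : ∀ e → 𝕋′.label (to e) ≡ 𝕋.label e
      -- Monotonicity is a field in both directions, so `≅-sym` merely exchanges the two.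
      to-mono   : ∀ {e f} → e 𝕋.≤ f → to e 𝕋′.≤ to f
      from-mono : ∀ {e f} → e 𝕋′.≤ f → from e 𝕋.≤ from f

  ≅-sym : ∀ {𝕋 𝕋′} → 𝕋 ≅ 𝕋′ → 𝕋′ ≅ 𝕋
  ≅-sym {𝕋′ = 𝕋′} θ = record
    { bijection = ↔-sym bijection
    ; label-to  = λ e → trans (sym (label-to (from e))) (cong (Trace.label 𝕋′) (strictlyInverseˡ e))
    ; to-mono   = from-mono
    ; from-mono = to-mono
    }
    where open _≅_ θ

  -- Membership is pulled back along `from`, which avoids an existential; `map to` turns a list of
  -- the events of `c` into one of the image.
  image : ∀ {𝕋 𝕋′} → 𝕋 ≅ 𝕋′ → Configuration 𝕋 → Configuration 𝕋′
  image θ c = record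
    { events     = events c ∘ from
    ; finite     = map to xs
                 , (λ {e} e∈c → subst (_∈ map to xs) (strictlyInverseˡ e) (∈-map⁺ to (c⊆xs e∈c)))
                 , λ e∈xs → let (x , x∈xs , e≡) = ∈-map⁻ to e∈xs in
                     subst (events c) (sym (trans (cong from e≡) (strictlyInverseʳ x))) (xs⊆c x∈xs)
    ; downClosed = λ x≤e → downClosed c (from-mono x≤e)
    }
    where
    open _≅_ θ
    xs   = proj₁ (finite c)
    c⊆xs = proj₁ (proj₂ (finite c))
    xs⊆c = proj₂ (proj₂ (finite c))

  module _ {𝕋 𝕋′ : Trace} (θ : 𝕋 ≅ 𝕋′) where
    open _≅_ θ

    -- A relation instead of an equation with `image θ c`: configurations carry predicates and
    -- finiteness witnesses, so equality would be too strict. With one inclusion along `to` and one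
    -- along `from`, inverting `θ` swaps the components.
    Corresponds : Configuration 𝕋 → Configuration 𝕋′ → Set
    Corresponds c c′ = events c ⊆ events c′ ∘ to × events c′ ⊆ events c ∘ from

    image-corresponds : ∀ c → Corresponds c (image θ c)
    image-corresponds c = (λ {e} → subst (events c) (sym (strictlyInverseʳ e))) , λ e∈ → e∈

    preimage-corresponds : ∀ c′ → Corresponds (image (≅-sym θ) c′) c′
    preimage-corresponds c′ = (λ e∈ → e∈) , λ {e} → subst (events c′) (sym (strictlyInverseˡ e))

    ⊆-transport : ∀ {c c′ d d′} → Corresponds c c′ → Corresponds d d′ →
                  events c ⊆ events d → events c′ ⊆ events d′
    ⊆-transport {d′ = d′} (_ , c′⊆c) (d⊆d′ , _) c⊆d {e} =
      subst (events d′) (strictlyInverseˡ e) ∘ d⊆d′ ∘ c⊆d ∘ c′⊆c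

    Step-transport : ∀ {a c c′ d} → Corresponds c c′ →
                     Step 𝕋 a c d → Step 𝕋′ a c′ (image θ d)
    Step-transport {c = c} {c′} {d} (c⊆c′ , c′⊆c) (e , e∉c , label≡a , d⊆ , d⊇) =
      to e
      , (λ e∈c′ → e∉c (subst (events c) (strictlyInverseʳ e) (c′⊆c e∈c′)))
      , trans (label-to e) label≡a
      , (λ {x} x∈d → Sum.map (λ x∈c → subst (events c′) (strictlyInverseˡ x) (c⊆c′ x∈c))
                             (λ e≡ → trans (cong to e≡) (strictlyInverseˡ x))
                             (d⊆ x∈d))
      , λ { (inj₁ x∈c′) → d⊇ (inj₁ (c′⊆c x∈c′))
          ; (inj₂ refl) → d⊇ (inj₂ (sym (strictlyInverseʳ e))) }

  Corresponds-sym : ∀ {𝕋 𝕋′} (θ : 𝕋 ≅ 𝕋′) {c c′} →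
                    Corresponds θ c c′ → Corresponds (≅-sym θ) c′ c
  Corresponds-sym θ (c⊆c′ , c′⊆c) = c′⊆c , c⊆c′

  -- Induction on `φ` with `θ` left general: negation and the universal clause of `_U_` also need
  -- the inverse isomorphism.
  ⊨-invariant : ∀ φ {𝕋 𝕋′} (θ : 𝕋 ≅ 𝕋′) {c c′} → Corresponds θ c c′ →
                𝕋 , c ⊨ φ → 𝕋′ , c′ ⊨ φ
  ⊨-invariant tt θ r sat = sat
  ⊨-invariant (¬′ φ) θ {c} {c′} r sat =
    sat ∘ ⊨-invariant φ (≅-sym θ) {c′} {c} (Corresponds-sym θ {c} {c′} r)
  ⊨-invariant (φ ∨′ ψ) θ {c} {c′} r =
    Sum.map (⊨-invariant φ θ {c} {c′} r) (⊨-invariant ψ θ {c} {c′} r)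
  ⊨-invariant (⟨ a ⟩ φ) θ {c} {c′} r (d , c→d , sat) =
    image θ d
    , Step-transport θ {c = c} {c′} {d} r c→d
    , ⊨-invariant φ θ {d} (image-corresponds θ d) sat
  ⊨-invariant (φ U ψ) {𝕋} {𝕋′} θ {c} {c′} r (d , c⊆d , satψ , satφ) =
    d′
    , ⊆-transport θ {c} {c′} {d} {d′} r rd c⊆d
    , ⊨-invariant ψ θ {d} rd satψ
    , λ x′ c′⊆x′ (x′⊆d′ , d′⊈x′) →
        -- An intermediate `x′` is pulled back to `x`. Then `x` lies between `c` and `d`, properly
        -- below `d` because `d ⊆ x` would give `d′ ⊆ x′`. So `φ` holds at `x` and is carried back
        -- to `x′`.
        let x    = image (≅-sym θ) x′
            rx   = preimage-corresponds θ x′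
            r⁻   = Corresponds-sym θ {c} {c′} r
            rd⁻  = Corresponds-sym θ {d} {d′} rd
            rx⁻  = Corresponds-sym θ {x} {x′} rx
        in ⊨-invariant φ θ {x} rx $
             satφ x (⊆-transport (≅-sym θ) {c′} {c} {x′} {x} r⁻ rx⁻ c′⊆x′)
                    ( ⊆-transport (≅-sym θ) {x′} {x} {d′} {d} rx⁻ rd⁻ x′⊆d′
                    , d′⊈x′ ∘ ⊆-transport θ {d} {d′} {x} {x′} rd rx )
    where
    d′ : Configuration 𝕋′
    d′ = image θ d
    rd : Corresponds θ d d′
    rd = image-corresponds θ d

  -- Rearrangements of infinite words that induce trace isomorphisms.

  record _∼_ (w w′ : ωWord) : Set where
    field
      bijection : ℕ ↔ ℕ
    open Inverse bijection public
    field
      letter-to : ∀ i → w′ (to i) ≡ w i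
      -- Only the generating pairs `Earlier` are constrained; `gmap` extends this to the trace order
      -- in `∼⇒≅`.
      to-<      : ∀ {i j} → Earlier w i j → to i ℕ.< to j
      from-<    : ∀ {i j} → Earlier w′ i j → from i ℕ.< from j

    letter-from : ∀ i → w (from i) ≡ w′ i
    letter-from i = trans (sym (letter-to (from i))) (cong w′ (strictlyInverseˡ i))

    to-Earlier : ∀ {i j} → Earlier w i j → Earlier w′ (to i) (to j)
    to-Earlier e = to-< e , subst₂ D (sym (letter-to _)) (sym (letter-to _)) (proj₂ e)

    from-Earlier : ∀ {i j} → Earlier w′ i j → Earlier w (from i) (from j)
    from-Earlier e = from-< e , subst₂ D (sym (letter-from _)) (sym (letter-from _)) (proj₂ e)

  ∼⇒≅ : ∀ {w w′} → w ∼ w′ → traceOf w ≅ traceOf w′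
  ∼⇒≅ θ = record
    { bijection = bijection
    ; label-to  = letter-to
    ; to-mono   = gmap to to-Earlier
    ; from-mono = gmap from from-Earlier
    }
    where open _∼_ θ

  ∼-refl : ∀ {w} → w ∼ w
  ∼-refl = record
    { bijection = ↔-id ℕ
    ; letter-to = λ _ → refl
    ; to-<      = proj₁
    ; from-<    = proj₁
    }

  ∼-trans : ∀ {w w′ w″} → w ∼ w′ → w′ ∼ w″ → w ∼ w″
  ∼-trans θ η = record
    { bijection = η.bijection ↔-∘ θ.bijection
    ; letter-to = λ i → trans (η.letter-to (θ.to i)) (θ.letter-to i)
    ; to-<      = η.to-< ∘ θ.to-Earlier
    ; from-<    = θ.from-< ∘ η.from-Earlier
    }
    where
    module θ = _∼_ θ
    module η = _∼_ η

  ∼-cons : ∀ a {u v σ τ} → (u ⌢ σ) ∼ (v ⌢ τ) → ((a ∷ u) ⌢ σ) ∼ ((a ∷ v) ⌢ τ)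
  ∼-cons a θ = record
    { bijection = mk↔ₛ′ (lift to) (lift from)
        (λ { zero → refl ; (suc i) → cong suc (strictlyInverseˡ i) })
        (λ { zero → refl ; (suc i) → cong suc (strictlyInverseʳ i) })
    ; letter-to = λ { zero → refl ; (suc i) → letter-to i }
    ; to-<      = λ { {zero}  {suc j} _ → z<s
                    ; {suc i} {suc j} (s<s i<j , d) → s<s (to-< (i<j , d)) }
    ; from-<    = λ { {zero}  {suc j} _ → z<s
                    ; {suc i} {suc j} (s<s i<j , d) → s<s (from-< (i<j , d)) }
    }
    where
    open _∼_ θ
    lift : (ℕ → ℕ) → ℕ → ℕ
    lift f zero    = zero
    lift f (suc i) = suc (f i)

  swap₀₁ : ℕ → ℕ
  swap₀₁ 0             = 1
  swap₀₁ 1             = 0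
  swap₀₁ (suc (suc i)) = suc (suc i)

  swap₀₁-involutive : ∀ i → swap₀₁ (swap₀₁ i) ≡ i
  swap₀₁-involutive 0             = refl
  swap₀₁-involutive 1             = refl
  swap₀₁-involutive (suc (suc i)) = refl

  -- The transposition reverses only the pair of positions 0 and 1, whose letters are independent,
  -- so it is no `Earlier` pair.
  swap₀₁-< : ∀ {a b} u {σ i j} → I a b →
             Earlier ((a ∷ b ∷ u) ⌢ σ) i j → swap₀₁ i ℕ.< swap₀₁ j
  swap₀₁-< u {i = 0} {1}           ab (_ , d) = ⊥-elim (d ab)
  swap₀₁-< u {i = 0} {suc (suc j)} ab _       = s<s z<s
  swap₀₁-< u {i = 1} {1}           ab (s<s () , _)
  swap₀₁-< u {i = 1} {suc (suc j)} ab _       = z<s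
  swap₀₁-< u {i = suc (suc i)} {1} ab (s<s () , _)
  swap₀₁-< u {i = suc (suc i)} {suc (suc j)} ab (i<j , _) = i<j

  ∼-swap : ∀ {a b} u {σ} → I a b → ((a ∷ b ∷ u) ⌢ σ) ∼ ((b ∷ a ∷ u) ⌢ σ)
  ∼-swap u ab = record
    { bijection = mk↔ₛ′ swap₀₁ swap₀₁ swap₀₁-involutive swap₀₁-involutive
    ; letter-to = λ { 0 → refl ; 1 → refl ; (suc (suc i)) → refl }
    ; to-<      = swap₀₁-< u ab
    ; from-<    = swap₀₁-< u (I-sym ab)
    }

  ∼-moveToFront : ∀ {a} x y {σ} → All (I a) x →
                  ((a ∷ x ++ y) ⌢ σ) ∼ ((x ++ a ∷ y) ⌢ σ)
  ∼-moveToFront []      y []         = ∼-refl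
  ∼-moveToFront {a} (b ∷ x) y (ab ∷ ax) =
    -- First `a` and `b` trade places, then `a` travels through the rest of `x` behind `b`.
    ∼-trans (∼-swap (x ++ y) ab) (∼-cons b {a ∷ x ++ y} {x ++ a ∷ y} (∼-moveToFront x y ax))

  -- Projections to two-letter cliques.

  pair : Letter → Letter → Letter → Bool
  pair a b c = ⌊ c ≟ a ⌋ ∨ ⌊ c ≟ b ⌋

  pair-clique : ∀ {a b} → D a b → DClique (pair a b)
  pair-clique {a} {b} ab c d pc pd with split c pc | split d pd
    where
    split : ∀ c → T (pair a b c) → c ≡ a ⊎ c ≡ b
    split c = Sum.map (toWitness {a? = c ≟ a}) (toWitness {a? = c ≟ b}) ∘ Equivalence.to T-∨
  ... | inj₁ refl | inj₁ refl = D-refl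
  ... | inj₁ refl | inj₂ refl = ab
  ... | inj₂ refl | inj₁ refl = D-sym ab
  ... | inj₂ refl | inj₂ refl = D-refl

  StartsWith : Letter → Word → Set
  StartsWith a w = ∃ λ t → w ≡ a ∷ t

  ↾-pair-head : ∀ a b w → StartsWith a ((a ∷ w) ↾ pair a b)
  ↾-pair-head a b w with a ≟ a
  ... | yes _  = _ , refl
  ... | no a≢a = ⊥-elim (a≢a refl)

  -- The clique contains the head `c` itself, so `c` survives and is the first letter of the
  -- projection.
  ↾-pair-head⁻¹ : ∀ {a c} w → StartsWith a ((c ∷ w) ↾ pair a c) → c ≡ a
  ↾-pair-head⁻¹ {a} {c} w (_ , eq) with c ≟ a | c ≟ c
  ... | yes c≡a | _      = c≡a
  ... | no _    | yes _  = ∷-injectiveˡ eq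
  ... | no _    | no c≢c = ⊥-elim (c≢c refl)

  -- `c` differs from `a` by irreflexivity of `I`, and from `b` because `a` depends on `b`.
  ↾-pair-skip : ∀ {a b c} w → I a c → D a b → (c ∷ w) ↾ pair a b ≡ w ↾ pair a b
  ↾-pair-skip {a} {b} {c} w ac ab with c ≟ a | c ≟ b
  ... | yes refl | _        = ⊥-elim (D-refl ac)
  ... | no _     | yes refl = ⊥-elim (ab ac)
  ... | no _     | no _     = refl

  -- Scan `u`. A head dependent on `a` must be `a`, by the projection to both letters. An
  -- independent head is erased by every projection considered, so the hypothesis passes to the
  -- tail.
  firstOccurrence : ∀ a u → (∀ b → D a b → StartsWith a (u ↾ pair a b)) →
                    ∃₂ λ x y → u ≡ x ++ a ∷ y × All (I a) x
  -- The choice of `a` for `b` rules out the empty word.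
  firstOccurrence a [] starts with starts a D-refl
  ... | _ , ()
  firstOccurrence a (c ∷ u) starts with I? a c
  ... | no ac with refl ← ↾-pair-head⁻¹ u (starts c ac) = [] , u , refl , []
  ... | yes ac =
    let starts′ b ab         = subst (StartsWith a) (↾-pair-skip u ac ab) (starts b ab)
        (x , y , u≡xay , ax) = firstOccurrence a u starts′
    in c ∷ x , y , cong (c ∷_) u≡xay , ac ∷ ax

  -- From equal projections to rearrangements.

  ≈-moveToFront : ∀ {a} x y → All (I a) x → (x ++ a ∷ y) ≈ (a ∷ x ++ y)
  ≈-moveToFront []      y [] p clique = refl
  ≈-moveToFront {a} (b ∷ x) y (ab ∷ ax) p clique
    with p a in pa | p b in pb | ≈-moveToFront x y ax p clique
  ... | true  | true  | _  =
    -- A clique cannot contain the independent letters `a` and `b` together; in the other cases at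
    -- most one survives, so their order is invisible.
    ⊥-elim (clique a b (subst T (sym pa) _) (subst T (sym pb) _) ab)
  ... | true  | false | ih rewrite pb = ih
  ... | false | true  | ih rewrite pb = cong (b ∷_) ih
  ... | false | false | ih rewrite pb = ih

  ≈-sym : ∀ {u v} → u ≈ v → v ≈ u
  ≈-sym u≈v p clique = sym (u≈v p clique)

  ≈-trans : ∀ {u v w} → u ≈ v → v ≈ w → u ≈ w
  ≈-trans u≈v v≈w p clique = trans (u≈v p clique) (v≈w p clique)

  ≈-tail : ∀ {a u v} → (a ∷ u) ≈ (a ∷ v) → u ≈ v
  ≈-tail {a} au≈av p clique with p a | au≈av p clique
  ... | true  | eq = ∷-injectiveʳ eq
  ... | false | eq = eq

  -- The first letter of a nonempty word survives the projection to its own singleton clique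
  -- `pair a a`.
  []≈⇒≡[] : ∀ u → [] ≈ u → u ≡ []
  []≈⇒≡[] []      _    = refl
  []≈⇒≡[] (a ∷ u) []≈u with ↾-pair-head a a u | []≈u (pair a a) (pair-clique D-refl)
  ... | _ , eq | eq′ with trans eq′ eq
  ... | ()

  -- Induction on `v` with `u` general, since the recursive call replaces `u` by `x ++ y`.
  ≈⇒∼ : ∀ v u {σ} → v ≈ u → (v ⌢ σ) ∼ (u ⌢ σ)
  ≈⇒∼ [] u v≈u with refl ← []≈⇒≡[] u v≈u = ∼-refl
  ≈⇒∼ (a ∷ v) u v≈u with firstOccurrence a u starts
    where
    starts : ∀ b → D a b → StartsWith a (u ↾ pair a b)
    starts b ab = subst (StartsWith a) (v≈u (pair a b) (pair-clique ab)) (↾-pair-head a b v)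
  ... | x , y , refl , ax =
    ∼-trans
      (∼-cons a {v} {x ++ y}
        (≈⇒∼ v (x ++ y) (≈-tail {a} {v} {x ++ y}
          (≈-trans {a ∷ v} {x ++ a ∷ y} {a ∷ x ++ y} v≈u (≈-moveToFront x y ax)))))
      (∼-moveToFront x y ax)

  -- Transfer to the three-valued semantics.

  ⊨-≈ : ∀ φ {u v} σ → u ≈ v → traceOf (u ⌢ σ) ⊨ φ → traceOf (v ⌢ σ) ⊨ φ
  ⊨-≈ φ {u} {v} σ u≈v = ⊨-invariant φ (∼⇒≅ (≈⇒∼ u v u≈v)) {∅ᶜ _} {∅ᶜ _} ((λ ()) , λ ())

  ⊤₃-≈ : ∀ φ {u v} → u ≈ v → [ u ⊨ᵗ φ ]≔ ⊤₃ → [ v ⊨ᵗ φ ]≔ ⊤₃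
  ⊤₃-≈ φ {u} {v} u≈v val σ = ⊨-≈ φ {u} {v} σ u≈v (val σ)

  ⊥₃-≈ : ∀ φ {u v} → u ≈ v → [ u ⊨ᵗ φ ]≔ ⊥₃ → [ v ⊨ᵗ φ ]≔ ⊥₃
  ⊥₃-≈ φ {u} {v} u≈v val σ = val σ ∘ ⊨-≈ φ {v} {u} σ (≈-sym {u} {v} u≈v)

  value-≈ : ∀ φ {u v} → u ≈ v → ∀ b → [ u ⊨ᵗ φ ]≔ b → [ v ⊨ᵗ φ ]≔ b
  value-≈ φ {u} {v} u≈v ⊤₃ = ⊤₃-≈ φ {u} {v} u≈v
  value-≈ φ {u} {v} u≈v ⊥₃ = ⊥₃-≈ φ {u} {v} u≈v
  -- Both components are negations, so the transfers of `⊤₃` and `⊥₃` are used from `v` to `u`.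
  value-≈ φ {u} {v} u≈v ?₃ (¬⊤ , ¬⊥) = ¬⊤ ∘ ⊤₃-≈ φ {v} {u} v≈u , ¬⊥ ∘ ⊥₃-≈ φ {v} {u} v≈u
    where
    v≈u : v ≈ u
    v≈u = ≈-sym {u} {v} u≈v

theorem3 : (𝔸 : TraceAlphabet) → let open OverAlphabet 𝔸 in
    (φ : LTL) (u v : Word) → v ≈ u →
    ∀ (b : 𝔹₃) → ([ u ⊨ᵗ φ ]≔ b) ⇔ ([ v ⊨ᵗ φ ]≔ b)
theorem3 𝔸 φ u v v≈u b =
  mk⇔ (value-≈ φ {u} {v} (≈-sym {v} {u} v≈u) b) (value-≈ φ {v} {u} v≈u b)
  where open TraceEquivalence 𝔸
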